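{- Let $G$ be a nilpotent group of class $k$, let $v(\bar x,\bar z)$ be a group word in variables $\bar x=(x_1,\dots,x_n)$, $\bar z$ and their inverses, and let $\bar g$ be a tuple of elements of $G$ (of the length of $\bar z$) and $c\in G$. If the set $\{\bar h\in G^n:v(\bar h,\bar g)=c\}$ is $2^k$-large in $G^n$, then $v(\bar h,\bar g)=c$ for all $\bar h\in G^n$.
   Context: A subset $X$ of a group $K$ is $m$-large in $K$ if the intersection of any $m$ left translates $a_1X\cap\dots\cap a_mX$ ($a_i\in K$) is non-empty. -}

module Defs where

open import Algebra.Bundles using (Group)
import Algebra.Construct.Pointwise as Pointwise
open import Data.Fin.Base using (Fin)
open import Data.List.Base using (List; []; _∷_)
open import Data.Nat.Base using (ℕ; zero; suc; _<_)
open import Data.Product.Base using (_×_; ∃-syntax)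
open import Data.Sum.Base using (_⊎_; [_,_]′)
open import Data.Unit.Base using (⊤)
open import Level using (Level; _⊔_; Lift)
open import Relation.Nullary.Negation using (¬_)
open import Relation.Unary using (Pred; _∈_; ⋂; Satisfiable)

private
  variable
    c ℓ p q : Level

infix 8 _^_

_^_ : Group c ℓ → ℕ → Group c ℓ
G ^ n = Pointwise.group (Fin n) G

module _ (K : Group c ℓ) where
  open Group K

  leftTranslate : Carrier → Pred Carrier p → Pred Carrier (c ⊔ ℓ ⊔ p)
  leftTranslate a X y = ∃[ x ] (x ∈ X × y ≈ a ∙ x)

  Large : ℕ → Pred Carrier p → Set (c ⊔ ℓ ⊔ p)
  Large m X = (a : Fin m → Carrier) →
              Satisfiable (⋂ (Fin m) λ i → leftTranslate (a i) X)

module _ (G : Group c ℓ) where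
  open Group G

  data Generated (S : Pred Carrier p) : Pred Carrier (c ⊔ ℓ ⊔ p) where
    gen  : ∀ {x} → x ∈ S → x ∈ Generated S
    unit : ε ∈ Generated S
    mult : ∀ {x y} → x ∈ Generated S → y ∈ Generated S → x ∙ y ∈ Generated S
    inv  : ∀ {x} → x ∈ Generated S → x ⁻¹ ∈ Generated S
    resp : ∀ {x y} → x ≈ y → x ∈ Generated S → y ∈ Generated S

  commutator : Carrier → Carrier → Carrier
  commutator x y = x ⁻¹ ∙ y ⁻¹ ∙ x ∙ y

  Commutators : Pred Carrier p → Pred Carrier q → Pred Carrier (c ⊔ ℓ ⊔ p ⊔ q)
  Commutators A B z = ∃[ x ] ∃[ y ] (x ∈ A × y ∈ B × z ≈ commutator x y)

  Whole : Pred Carrier (c ⊔ ℓ)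
  Whole _ = Lift (c ⊔ ℓ) ⊤

  -- Indexed from zero: lowerCentral i is the subgroup usually written γᵢ₊₁(G).
  lowerCentral : ℕ → Pred Carrier (c ⊔ ℓ)
  lowerCentral zero    = Whole
  lowerCentral (suc i) = Generated (Commutators (lowerCentral i) Whole)

  Trivial : Pred Carrier p → Set (c ⊔ ℓ ⊔ p)
  Trivial A = ∀ {x} → x ∈ A → x ≈ ε

  -- The class is exactly k: the lower central series first becomes trivial
  -- after k steps.
  NilpotentOfClass : ℕ → Set (c ⊔ ℓ)
  NilpotentOfClass k = Trivial (lowerCentral k) ×
                       (∀ j → j < k → ¬ Trivial (lowerCentral j))

data Letter {a} (A : Set a) : Set a where
  pos neg : A → Letter A

-- Words need not be reduced.
GroupWord : ∀ {a} → Set a → Set a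
GroupWord A = List (Letter A)

module _ (G : Group c ℓ) where
  open Group G

  evalLetter : ∀ {a} {A : Set a} → (A → Carrier) → Letter A → Carrier
  evalLetter ρ (pos x) = ρ x
  evalLetter ρ (neg x) = ρ x ⁻¹

  eval : ∀ {a} {A : Set a} → (A → Carrier) → GroupWord A → Carrier
  eval ρ []      = ε
  eval ρ (l ∷ w) = evalLetter ρ l ∙ eval ρ w

  -- The value v(h̄, ḡ), where Fin n indexes the x̄ and Fin l the z̄.
  value : ∀ {n l} → GroupWord (Fin n ⊎ Fin l) →
          (Fin n → Carrier) → (Fin l → Carrier) → Carrier
  value v h g = eval [ h , g ]′ v

{-# OPTIONS --safe #-}

-- The maps K → G generated from constants and homomorphisms by pointwise
-- products, inverses and commutators are filtered by weight, where a constant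
-- from γᵢ has weight i (with γ₀ = γ₁ = G), a homomorphism has weight 0, and
-- weights add under commutators.  A map of weight i takes values in γᵢ, and its
-- derivative D h f y = f (h y) · f (y)⁻¹ has weight i + 1.  If {f = c} is
-- 2^(m+1)-large, then {D h f = 1} is 2^m-large, since it contains X ∩ h⁻¹X for
-- X = {f = c}.  A map of weight k has derivatives with values in γₖ₊₁ = 1, so
-- by downward induction on the weight all derivatives vanish and f is constant.
module Submission where

open import Defs
open import Algebra.Bundles using (Group)
import Algebra.Morphism.Structures as Morphisms
import Algebra.Properties.Group as GroupProperties
open import Data.Fin.Base using (Fin; zero; suc; combine; remQuot)
open import Data.Fin.Properties using (_≟_; remQuot-combine)
open import Data.List.Base using ([]; _∷_)
open import Data.Nat.Base as ℕ using (ℕ; zero; suc; pred; _≤_; z≤n; s≤s)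
import Data.Nat.Properties as ℕ
open import Data.Product.Base using (_×_; _,_; proj₁; proj₂)
open import Data.Sum.Base using (_⊎_; inj₁; inj₂; [_,_]′)
open import Data.Vec.Base using (Vec; lookup)
open import Level using (Level; _⊔_)
open import Relation.Binary.PropositionalEquality as ≡ using ()
import Relation.Binary.Reflection as Reflection
open import Relation.Nullary.Decidable.Core using (yes; no)
open import Relation.Unary using (Pred; _∈_; _⊆_; Satisfiable)

private
  variable
    c ℓ c′ ℓ′ p q : Level

-- Proving group identities by free reduction

module GroupSolver (G : Group c ℓ) where
  open Group G
  open GroupProperties G using (⁻¹-anti-homo-∙; ⁻¹-involutive;
    \\-leftDividesˡ; \\-leftDividesʳ)

  infixl 7 _⊙_
  infix  8 _ⁱ

  data Expr (n : ℕ) : Set where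
    var : Fin n → Expr n
    _⊙_ : Expr n → Expr n → Expr n
    _ⁱ  : Expr n → Expr n

  ⟦_⟧ : ∀ {n} → Expr n → Vec Carrier n → Carrier
  ⟦ var x ⟧ ρ = lookup ρ x
  ⟦ s ⊙ t ⟧ ρ = ⟦ s ⟧ ρ ∙ ⟦ t ⟧ ρ
  ⟦ t ⁱ ⟧   ρ = ⟦ t ⟧ ρ ⁻¹

  conj : ∀ {n} → Expr n → Expr n → Expr n
  conj s t = t ⁱ ⊙ s ⊙ t

  comm : ∀ {n} → Expr n → Expr n → Expr n
  comm s t = s ⁱ ⊙ t ⁱ ⊙ s ⊙ t

  push : ∀ {n} → Letter (Fin n) → GroupWord (Fin n) → GroupWord (Fin n)
  push (pos x) (neg y ∷ w) with x ≟ y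
  ... | yes _ = w
  ... | no  _ = pos x ∷ neg y ∷ w
  push (neg x) (pos y ∷ w) with x ≟ y
  ... | yes _ = w
  ... | no  _ = neg x ∷ pos y ∷ w
  push a w = a ∷ w

  mutual
    -- Left multiplication on reduced words, started at the empty word, yields the free normal form.
    -- Carrying `act⁻¹` along handles inverses without reversing words. Both sides of an identity
    -- valid in all groups get the same normal form, so `refl` closes it.
    act : ∀ {n} → Expr n → GroupWord (Fin n) → GroupWord (Fin n)
    act (var x) w = push (pos x) w
    act (s ⊙ t) w = act s (act t w)
    act (t ⁱ)   w = act⁻¹ t w

    act⁻¹ : ∀ {n} → Expr n → GroupWord (Fin n) → GroupWord (Fin n)
    act⁻¹ (var x) w = push (neg x) w
    act⁻¹ (s ⊙ t) w = act⁻¹ t (act⁻¹ s w)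
    act⁻¹ (t ⁱ)   w = act t w

  ⟦_⇓⟧ : ∀ {n} → Expr n → Vec Carrier n → Carrier
  ⟦ t ⇓⟧ ρ = eval G (lookup ρ) (act t [])

  module _ {n : ℕ} (ρ : Vec Carrier n) where
    private
      ev : GroupWord (Fin n) → Carrier
      ev = eval G (lookup ρ)

    push-correct : ∀ a w → ev (push a w) ≈ ev (a ∷ w)
    push-correct (pos x) [] = refl
    push-correct (pos x) (pos y ∷ w) = refl
    push-correct (pos x) (neg y ∷ w) with x ≟ y
    ... | yes ≡.refl = sym (\\-leftDividesˡ (lookup ρ x) (ev w))
    ... | no  _ = refl
    push-correct (neg x) [] = refl
    push-correct (neg x) (neg y ∷ w) = refl
    push-correct (neg x) (pos y ∷ w) with x ≟ y
    ... | yes ≡.refl = sym (\\-leftDividesʳ (lookup ρ x) (ev w))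
    ... | no  _ = refl

    mutual
      act-correct : ∀ t w → ev (act t w) ≈ ⟦ t ⟧ ρ ∙ ev w
      act-correct (var x) w = push-correct (pos x) w
      act-correct (s ⊙ t) w = trans (act-correct s (act t w))
        (trans (∙-congˡ (act-correct t w)) (sym (assoc _ _ _)))
      act-correct (t ⁱ) w = act⁻¹-correct t w

      act⁻¹-correct : ∀ t w → ev (act⁻¹ t w) ≈ ⟦ t ⟧ ρ ⁻¹ ∙ ev w
      act⁻¹-correct (var x) w = push-correct (neg x) w
      act⁻¹-correct (s ⊙ t) w = trans (act⁻¹-correct t (act⁻¹ s w))
        (trans (∙-congˡ (act⁻¹-correct s w))
        (trans (sym (assoc _ _ _)) (∙-congʳ (sym (⁻¹-anti-homo-∙ _ _)))))
      act⁻¹-correct (t ⁱ) w = trans (act-correct t w)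
        (∙-congʳ (sym (⁻¹-involutive _)))

  correct : ∀ {n} (t : Expr n) ρ → ⟦ t ⇓⟧ ρ ≈ ⟦ t ⟧ ρ
  correct t ρ = trans (act-correct ρ t []) (identityʳ _)

  open Reflection setoid var ⟦_⟧ ⟦_⇓⟧ correct public using (solve; _⊜_)

-- Identities for conjugates and commutators

module _ (G : Group c ℓ) where
  open Group G

  conjugate : Carrier → Carrier → Carrier
  conjugate x g = g ⁻¹ ∙ x ∙ g

  conjugate-cong : ∀ {x y} g → x ≈ y → conjugate x g ≈ conjugate y g
  conjugate-cong g x≈y = ∙-congʳ (∙-congˡ x≈y)

  commutator-cong : ∀ {x y u v} → x ≈ y → u ≈ v →
                    commutator G x u ≈ commutator G y v
  commutator-cong x≈y u≈v =
    ∙-cong (∙-cong (∙-cong (⁻¹-cong x≈y) (⁻¹-cong u≈v)) x≈y) u≈v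

module GroupIdentities (G : Group c ℓ) where
  open Group G
  open GroupSolver G

  private
    _^ᶜ_ : Carrier → Carrier → Carrier
    _^ᶜ_ = conjugate G

    ⁅_,_⁆ : Carrier → Carrier → Carrier
    ⁅_,_⁆ = commutator G

  conjugate-∙ : ∀ x y g → (x ∙ y) ^ᶜ g ≈ x ^ᶜ g ∙ y ^ᶜ g
  conjugate-∙ = solve 3 (λ x y g →
    conj (x ⊙ y) g ⊜ conj x g ⊙ conj y g) refl

  conjugate-⁻¹ : ∀ x g → (x ⁻¹) ^ᶜ g ≈ (x ^ᶜ g) ⁻¹
  conjugate-⁻¹ = solve 2 (λ x g → conj (x ⁱ) g ⊜ (conj x g) ⁱ) refl

  conjugate-commutator : ∀ x y g → ⁅ x , y ⁆ ^ᶜ g ≈ ⁅ x ^ᶜ g , y ^ᶜ g ⁆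
  conjugate-commutator = solve 3 (λ x y g →
    conj (comm x y) g ⊜ comm (conj x g) (conj y g)) refl

  commutator≈⁻¹∙conjugate : ∀ x y → ⁅ x , y ⁆ ≈ x ⁻¹ ∙ x ^ᶜ y
  commutator≈⁻¹∙conjugate = solve 2 (λ x y → comm x y ⊜ x ⁱ ⊙ conj x y) refl

  conjugate≈∙commutator : ∀ x g → x ^ᶜ g ≈ x ∙ ⁅ x , g ⁆
  conjugate≈∙commutator = solve 2 (λ x g → conj x g ⊜ x ⊙ comm x g) refl

  commutator-⁻¹ : ∀ x y → ⁅ x , y ⁆ ⁻¹ ≈ ⁅ y , x ⁆
  commutator-⁻¹ = solve 2 (λ x y → (comm x y) ⁱ ⊜ comm y x) refl

  commutator-∙ʳ : ∀ x y z → ⁅ x , y ∙ z ⁆ ≈ ⁅ x , z ⁆ ∙ ⁅ x , y ⁆ ^ᶜ z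
  commutator-∙ʳ = solve 3 (λ x y z →
    comm x (y ⊙ z) ⊜ comm x z ⊙ conj (comm x y) z) refl

  commutator-⁻¹ʳ : ∀ x y → ⁅ x , y ⁻¹ ⁆ ≈ (⁅ x , y ⁆ ⁻¹) ^ᶜ (y ⁻¹)
  commutator-⁻¹ʳ = solve 2 (λ x y →
    comm x (y ⁱ) ⊜ conj ((comm x y) ⁱ) (y ⁱ)) refl

  -- The Hall-Witt identity solved for one factor: a normal subgroup containing the two double
  -- commutators on the right contains the one on the left.
  hall-witt : ∀ x y z →
    ⁅ x , ⁅ y , z ⁆ ⁆ ≈
    (⁅ ⁅ z ⁻¹ , x ⁻¹ ⁆ , y ⁆ ^ᶜ x ∙ ⁅ ⁅ x , y ⁻¹ ⁆ , z ⁻¹ ⁆ ^ᶜ y) ^ᶜ z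
  hall-witt = solve 3 (λ x y z →
    comm x (comm y z) ⊜
    conj (conj (comm (comm (z ⁱ) (x ⁱ)) y) x
          ⊙ conj (comm (comm x (y ⁱ)) (z ⁱ)) y) z) refl

  -- This and the next two are the product, inverse and commutator rules for `D`: `x`, `u` stand for
  -- values at `h y`, and `y`, `v` for values at `y`.
  quotient-∙ : ∀ x y u v →
    (x ∙ u) ∙ (y ∙ v) ⁻¹ ≈ (x ∙ y ⁻¹) ∙ (u ∙ v ⁻¹) ^ᶜ (y ⁻¹)
  quotient-∙ = solve 4 (λ x y u v →
    (x ⊙ u) ⊙ (y ⊙ v) ⁱ ⊜ (x ⊙ y ⁱ) ⊙ conj (u ⊙ v ⁱ) (y ⁱ)) refl

  quotient-⁻¹ : ∀ x y → x ⁻¹ ∙ (y ⁻¹) ⁻¹ ≈ ((x ∙ y ⁻¹) ⁻¹) ^ᶜ y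
  quotient-⁻¹ = solve 2 (λ x y →
    x ⁱ ⊙ (y ⁱ) ⁱ ⊜ conj ((x ⊙ y ⁱ) ⁱ) y) refl

  -- Apart from conjugators, every commutator on the right has an entry `a` or `b`, that is, a
  -- derivative; this is what raises the weight.
  quotient-commutator : ∀ x y u v →
    let a = x ∙ y ⁻¹ ; b = u ∙ v ⁻¹ in
    ⁅ x , u ⁆ ∙ ⁅ y , v ⁆ ⁻¹ ≈
    (⁅ a , v ⁆ ∙ ⁅ a , b ⁆ ^ᶜ v) ^ᶜ y ∙ (⁅ y , b ⁆ ^ᶜ v) ^ᶜ (⁅ y , v ⁆ ⁻¹)
  quotient-commutator = solve 4 (λ x y u v →
    let a = x ⊙ y ⁱ ; b = u ⊙ v ⁱ in
    comm x u ⊙ (comm y v) ⁱ ⊜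
    conj (comm a v ⊙ conj (comm a b) v) y
      ⊙ conj (conj (comm y b) v) ((comm y v) ⁱ)) refl

-- The lower central series

module _ (G : Group c ℓ) where
  open Group G

  record IsNormalSubgroup (N : Pred Carrier p) : Set (c ⊔ ℓ ⊔ p) where
    field
      ε-closed  : ε ∈ N
      ∙-closed  : ∀ {x y} → x ∈ N → y ∈ N → x ∙ y ∈ N
      ⁻¹-closed : ∀ {x} → x ∈ N → x ⁻¹ ∈ N
      ≈-closed  : ∀ {x y} → x ≈ y → x ∈ N → y ∈ N
      conjugate-closed : ∀ {x} g → x ∈ N → conjugate G x g ∈ N

module LowerCentralSeries (G : Group c ℓ) where
  open Group G
  open GroupIdentities G

  private
    γ : ℕ → Pred Carrier (c ⊔ ℓ)
    γ = lowerCentral G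

  Whole-normal : IsNormalSubgroup G (Whole G)
  Whole-normal = record
    { ε-closed = _ ; ∙-closed = _ ; ⁻¹-closed = _ ; ≈-closed = _
    ; conjugate-closed = _ }

  Generated-normal : {S : Pred Carrier p} →
    (∀ {x} g → x ∈ S → conjugate G x g ∈ S) →
    IsNormalSubgroup G (Generated G S)
  Generated-normal {S = S} S-closed = record
    { ε-closed = unit ; ∙-closed = mult ; ⁻¹-closed = inv ; ≈-closed = resp
    ; conjugate-closed = closed }
    where
    closed : ∀ {x} g → x ∈ Generated G S → conjugate G x g ∈ Generated G S
    closed g (gen x∈)     = gen (S-closed g x∈)
    closed g unit         = resp (sym (trans (∙-congʳ (identityʳ _)) (inverseˡ g))) unit
    closed g (mult x∈ y∈) = resp (sym (conjugate-∙ _ _ g)) (mult (closed g x∈) (closed g y∈))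
    closed g (inv x∈)     = resp (sym (conjugate-⁻¹ _ g)) (inv (closed g x∈))
    closed g (resp eq x∈) = resp (conjugate-cong G g eq) (closed g x∈)

  lowerCentral-normal : ∀ i → IsNormalSubgroup G (γ i)
  lowerCentral-normal zero    = Whole-normal
  lowerCentral-normal (suc i) = Generated-normal
    λ { g (x , y , x∈ , _ , eq) →
        conjugate G x g , conjugate G y g , conjugate-closed g x∈ , _ ,
        trans (conjugate-cong G g eq) (conjugate-commutator x y g) }
    where open IsNormalSubgroup (lowerCentral-normal i)

  Generated-⊆ : {S : Pred Carrier p} {N : Pred Carrier q} →
                IsNormalSubgroup G N → S ⊆ N → Generated G S ⊆ N
  Generated-⊆ {S = S} {N = N} N-normal S⊆N = go
    where
    open IsNormalSubgroup N-normal
    go : Generated G S ⊆ N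
    go (gen x∈)     = S⊆N x∈
    go unit         = ε-closed
    go (mult x∈ y∈) = ∙-closed (go x∈) (go y∈)
    go (inv x∈)     = ⁻¹-closed (go x∈)
    go (resp eq x∈) = ≈-closed eq (go x∈)

  lowerCentral-suc-⊆ : ∀ i → γ (suc i) ⊆ γ i
  lowerCentral-suc-⊆ i = Generated-⊆ (lowerCentral-normal i)
    λ { (x , y , x∈ , _ , eq) →
        ≈-closed (sym (trans eq (commutator≈⁻¹∙conjugate x y)))
          (∙-closed (⁻¹-closed x∈) (conjugate-closed y x∈)) }
    where open IsNormalSubgroup (lowerCentral-normal i)

  lowerCentral-antitone : ∀ {i j} → i ≤ j → γ j ⊆ γ i
  lowerCentral-antitone {j = zero}  z≤n = _
  lowerCentral-antitone {i} {suc j} i≤1+j x∈ with i ℕ.≟ suc j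
  ... | yes ≡.refl = x∈
  ... | no  i≢1+j  = lowerCentral-antitone
    (ℕ.≤-pred (ℕ.≤∧≢⇒< i≤1+j i≢1+j)) (lowerCentral-suc-⊆ j x∈)

  -- The three subgroups argument, by induction on `j` for all `i` at once. The `suc` comes from
  -- indexing the series from zero.
  commutator∈lowerCentral : ∀ j i {x y} → x ∈ γ i → y ∈ γ j →
                            commutator G x y ∈ γ (suc (j ℕ.+ i))
  commutator∈lowerCentral zero i x∈ _ = gen (_ , _ , x∈ , _ , refl)
  commutator∈lowerCentral (suc j) i {x} x∈ y∈ = go y∈
    where
    open IsNormalSubgroup (lowerCentral-normal (suc (suc j ℕ.+ i)))

    bracket : ∀ {a b} → a ∈ γ j → commutator G x (commutator G a b) ∈ γ (suc (suc j ℕ.+ i))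
    bracket {a} {b} a∈ = ≈-closed (sym (hall-witt x a b)) (conjugate-closed b
      -- In the first factor, `a` sits in `γ j` and the inner commutator in `γ (suc i)`, so
      -- induction applies with `suc i`. In the second, induction places the inner commutator in
      -- `γ (suc (j + i))`, and commuting with `b ⁻¹` gains one more step.
      (∙-closed
        (conjugate-closed x (≡.subst (λ m → commutator G [b⁻¹,x⁻¹] a ∈ γ (suc m))
          (ℕ.+-suc j i) (commutator∈lowerCentral j (suc i) [b⁻¹,x⁻¹]∈ a∈)))
        (conjugate-closed a (gen (_ , _ ,
          commutator∈lowerCentral j i x∈ (γⱼ.⁻¹-closed a∈) , _ , refl)))))
      where
      module γᵢ = IsNormalSubgroup (lowerCentral-normal i)
      module γⱼ = IsNormalSubgroup (lowerCentral-normal j)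
      [b⁻¹,x⁻¹] : Carrier
      [b⁻¹,x⁻¹] = commutator G (b ⁻¹) (x ⁻¹)

      [b⁻¹,x⁻¹]∈ : [b⁻¹,x⁻¹] ∈ γ (suc i)
      [b⁻¹,x⁻¹]∈ = resp (commutator-⁻¹ _ _)
        (inv (gen (_ , _ , γᵢ.⁻¹-closed x∈ , _ , refl)))

    -- The `y` whose commutator with `x` lies in a given normal subgroup form a subgroup, so
    -- generators suffice.
    go : ∀ {y} → y ∈ γ (suc j) → commutator G x y ∈ γ (suc (suc j ℕ.+ i))
    go (gen (_ , _ , a∈ , _ , eq)) =
      ≈-closed (commutator-cong G refl (sym eq)) (bracket a∈)
    go unit = ≈-closed
      (sym (trans (commutator≈⁻¹∙conjugate x ε)
        (trans (∙-congˡ (trans (identityʳ _) (trans (∙-congʳ ε⁻¹≈ε) (identityˡ x))))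
          (inverseˡ x)))) ε-closed
      where open GroupProperties G using (ε⁻¹≈ε)
    go (mult u∈ v∈) = ≈-closed (sym (commutator-∙ʳ x _ _))
      (∙-closed (go v∈) (conjugate-closed _ (go u∈)))
    go (inv u∈) = ≈-closed (sym (commutator-⁻¹ʳ x _))
      (conjugate-closed _ (⁻¹-closed (go u∈)))
    go (resp eq u∈) = ≈-closed (commutator-cong G refl eq) (go u∈)

-- Polynomial maps

-- A point of any translate of `X` yields a point of `X`; `m` is non-zero so that there is a
-- translate to look at.
Large⇒Satisfiable : (K : Group c ℓ) {X : Pred (Group.Carrier K) p} →
                    ∀ m .{{_ : ℕ.NonZero m}} → Large K m X → Satisfiable X
Large⇒Satisfiable K (suc m) large with large (λ _ → Group.ε K)
... | _ , z∈ with z∈ zero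
... | x , x∈ , _ = x , x∈

module PolynomialMaps (K : Group c′ ℓ′) (G : Group c ℓ) where
  private
    module K = Group K
  open Group G
  open Morphisms.MagmaMorphisms K.rawMagma rawMagma using (IsMagmaHomomorphism)
  open GroupIdentities G
  open LowerCentralSeries G

  -- lowerCentral i is γᵢ₊₁, so this γ i is γᵢ with the convention γ₀ = γ₁ = G.
  γ : ℕ → Pred Carrier (c ⊔ ℓ)
  γ i = lowerCentral G (pred i)

  -- The index is a lower bound for the weight: allowing any `m ≤ i + j` in `comm` lets the factors
  -- of a product share one index. `resp` stands in for function extensionality.
  data Polynomial : ℕ → Pred (K.Carrier → Carrier) (c′ ⊔ ℓ′ ⊔ c ⊔ ℓ) where
    const : ∀ {i g} → g ∈ γ i → Polynomial i (λ _ → g)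
    hom   : ∀ {φ} → IsMagmaHomomorphism φ → Polynomial 0 φ
    mult  : ∀ {i f g} → Polynomial i f → Polynomial i g →
            Polynomial i (λ y → f y ∙ g y)
    inv   : ∀ {i f} → Polynomial i f → Polynomial i (λ y → f y ⁻¹)
    comm  : ∀ {i j m f g} → m ≤ i ℕ.+ j → Polynomial i f → Polynomial j g →
            Polynomial m (λ y → commutator G (f y) (g y))
    resp  : ∀ {i f g} → (∀ y → f y ≈ g y) → Polynomial i f → Polynomial i g

  polynomial-cong : ∀ {i f} → Polynomial i f → ∀ {x y} → x K.≈ y → f x ≈ f y
  polynomial-cong (const _)     x≈y = refl
  polynomial-cong (hom φ-hom)   x≈y = IsMagmaHomomorphism.⟦⟧-cong φ-hom x≈y
  polynomial-cong (mult pf pg)  x≈y = ∙-cong (polynomial-cong pf x≈y) (polynomial-cong pg x≈y)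
  polynomial-cong (inv pf)      x≈y = ⁻¹-cong (polynomial-cong pf x≈y)
  polynomial-cong (comm _ pf pg) x≈y =
    commutator-cong G (polynomial-cong pf x≈y) (polynomial-cong pg x≈y)
  polynomial-cong (resp eq pf)  x≈y =
    trans (sym (eq _)) (trans (polynomial-cong pf x≈y) (eq _))

  commutator∈γ : ∀ {i j m} → m ≤ i ℕ.+ j → ∀ {x y} → x ∈ γ i → y ∈ γ j →
                 commutator G x y ∈ γ m
  commutator∈γ {i} {j} m≤i+j x∈ y∈ = lowerCentral-antitone
    (ℕ.≤-trans (ℕ.pred-mono-≤ m≤i+j) (bound i j))
    (commutator∈lowerCentral (pred j) (pred i) x∈ y∈)
    where
    -- Equality holds when both weights are positive. If one is 0, there is a step to spare, because
    -- `γ 0` and `γ 1` coincide.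
    bound : ∀ i j → pred (i ℕ.+ j) ≤ suc (pred j ℕ.+ pred i)
    bound zero    j       = ℕ.m≤n⇒m≤1+n (ℕ.m≤m+n (pred j) 0)
    bound (suc i) zero    = ℕ.m≤n⇒m≤1+n (ℕ.≤-reflexive (ℕ.+-identityʳ i))
    bound (suc i) (suc j) = ℕ.≤-reflexive
      (≡.trans (ℕ.+-suc i j) (≡.cong suc (ℕ.+-comm i j)))

  polynomial-value : ∀ {i f} → Polynomial i f → ∀ y → f y ∈ γ i
  polynomial-value (const g∈) y = g∈
  polynomial-value (hom _) y = _
  polynomial-value {i} (mult pf pg) y =
    IsNormalSubgroup.∙-closed (lowerCentral-normal (pred i))
      (polynomial-value pf y) (polynomial-value pg y)
  polynomial-value {i} (inv pf) y =
    IsNormalSubgroup.⁻¹-closed (lowerCentral-normal (pred i)) (polynomial-value pf y)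
  polynomial-value (comm {i} {j} m≤i+j pf pg) y =
    commutator∈γ {i} {j} m≤i+j (polynomial-value pf y) (polynomial-value pg y)
  polynomial-value {i} (resp eq pf) y =
    IsNormalSubgroup.≈-closed (lowerCentral-normal (pred i)) (eq y) (polynomial-value pf y)

  -- The correction factor `[f, g]` has weight at least `i + j ≥ i`, so conjugation by a map of any
  -- weight is harmless.
  polynomial-conjugate : ∀ {i j f g} → Polynomial i f → Polynomial j g →
                         Polynomial i (λ y → conjugate G (f y) (g y))
  polynomial-conjugate {i} {j} pf pg = resp (λ y → sym (conjugate≈∙commutator _ _))
    (mult pf (comm (ℕ.m≤m+n i j) pf pg))

  D : K.Carrier → (K.Carrier → Carrier) → K.Carrier → Carrier
  D h f y = f (h K.∙ y) ∙ f y ⁻¹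

  -- Induction on the construction of `f`: the quotient identities express the derivative through
  -- derivatives of the parts, up to conjugation.
  polynomial-D : ∀ {i f} h → Polynomial i f → Polynomial (suc i) (D h f)
  polynomial-D {i} h (const _) = resp (λ _ → sym (inverseʳ _))
    (const (IsNormalSubgroup.ε-closed (lowerCentral-normal i)))
  -- The derivative is the constant `φ h`. It has weight 1 because `γ 1` is all of `G`.
  polynomial-D h (hom {φ} φ-hom) = resp
    (λ y → sym (trans (∙-congʳ (homo h y)) (//-rightDividesʳ (φ y) (φ h))))
    (const _)
    where
    open IsMagmaHomomorphism φ-hom using (homo)
    open GroupProperties G using (//-rightDividesʳ)
  polynomial-D h (mult pf pg) = resp (λ y → sym (quotient-∙ _ _ _ _))
    (mult (polynomial-D h pf) (polynomial-conjugate (polynomial-D h pg) (inv pf)))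
  polynomial-D h (inv pf) = resp (λ y → sym (quotient-⁻¹ _ _))
    (polynomial-conjugate (inv (polynomial-D h pf)) pf)
  -- The commutators `[Df, g]`, `[Df, Dg]` and `[f, Dg]` have weights `i + j + 1`, `i + j + 2` and
  -- `i + j + 1`, all at least `m + 1`.
  polynomial-D h (comm {i} {j} m≤i+j pf pg) =
    resp (λ y → sym (quotient-commutator _ _ _ _))
      (mult
        (polynomial-conjugate
          (mult (comm (s≤s m≤i+j) pDf pg)
            (polynomial-conjugate (comm (s≤s (ℕ.≤-trans m≤i+j i+j≤i+1+j)) pDf pDg) pg))
          pf)
        (polynomial-conjugate
          (polynomial-conjugate
            (comm (ℕ.≤-trans (s≤s m≤i+j) (ℕ.≤-reflexive (≡.sym (ℕ.+-suc i j)))) pf pDg) pg)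
          (inv (comm m≤i+j pf pg))))
    where
    pDf = polynomial-D h pf
    pDg = polynomial-D h pg
    i+j≤i+1+j : i ℕ.+ j ≤ i ℕ.+ suc j
    i+j≤i+1+j = ℕ.+-monoʳ-≤ i (ℕ.n≤1+n j)
  polynomial-D h (resp eq pf) =
    resp (λ y → ∙-cong (eq _) (⁻¹-cong (eq _))) (polynomial-D h pf)

  -- Large fibres and constancy

  module _ {i f} (pf : Polynomial i f) {d : Carrier} where
    private
      module KP = GroupProperties K

    D-large : ∀ m h → Large K (2 ℕ.* m) (λ y → f y ≈ d) →
              Large K m (λ y → D h f y ≈ ε)
    D-large m h large a = z , λ j → intersect j (z∈ zero j) (z∈ (suc zero) j)
      where
      -- For each `j` the two translates `a j X` and `a j h⁻¹ X` meet in the translate of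
      -- `X ∩ h⁻¹ X` by `a j`.
      b : Fin 2 × Fin m → K.Carrier
      b (zero  , j) = a j
      b (suc _ , j) = a j K.∙ h K.⁻¹

      z : K.Carrier
      z = proj₁ (large λ r → b (remQuot {2} m r))

      translate∋z : Pred (Fin 2 × Fin m) (c′ ⊔ ℓ′ ⊔ ℓ)
      translate∋z r = z ∈ leftTranslate K (b r) (λ y → f y ≈ d)

      z∈ : ∀ q j → translate∋z (q , j)
      z∈ q j = ≡.subst translate∋z (remQuot-combine q j)
        (proj₂ (large λ r → b (remQuot {2} m r)) (combine q j))

      intersect : ∀ j → translate∋z (zero , j) → translate∋z (suc zero , j) →
                  z ∈ leftTranslate K (a j) (λ y → D h f y ≈ ε)
      intersect j (x , fx≈d , z≈ajx) (x′ , fx′≈d , z≈ajh⁻¹x′) =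
        x , trans (∙-congʳ (trans (polynomial-cong pf hx≈x′) fx′≈d))
              (trans (∙-congˡ (⁻¹-cong fx≈d)) (inverseʳ d)) , z≈ajx
        where
        -- Cancelling `a j` between the two expressions for `z` gives `x = h⁻¹ x′`.
        hx≈x′ : h K.∙ x K.≈ x′
        hx≈x′ = K.trans (K.∙-congˡ (KP.∙-cancelˡ (a j) _ _
          (K.trans (K.sym z≈ajx) (K.trans z≈ajh⁻¹x′ (K.assoc _ _ _)))))
          (KP.\\-leftDividesˡ h x′)

    -- The shift by `h x⁻¹` carries the known point `x` of the fibre to `h`.
    D-trivial⇒const : (∀ h y → D h f y ≈ ε) → Satisfiable (λ y → f y ≈ d) →
                      ∀ h → f h ≈ d
    D-trivial⇒const D≈ε (x , fx≈d) h = trans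
      (polynomial-cong pf (K.sym (KP.//-rightDividesˡ x h)))
      (trans (x∙y⁻¹≈ε⇒x≈y _ _ (D≈ε (h K.∙ x K.⁻¹) x)) fx≈d)
      where open GroupProperties G using (x∙y⁻¹≈ε⇒x≈y)

  -- Each derivative trades one unit of `m` for one of weight, so `m + i` is invariant. The
  -- induction hypothesis is applied to `D h f` with the value `ε`.
  polynomial-const : ∀ m {i f d} → Trivial G (γ (suc (m ℕ.+ i))) → Polynomial i f →
                     Large K (2 ℕ.^ m) (λ y → f y ≈ d) → ∀ h → f h ≈ d
  polynomial-const m {i} {f} {d} triv pf large =
    D-trivial⇒const pf (D≈ε m triv large)
      (Large⇒Satisfiable K (2 ℕ.^ m) {{ℕ.m^n≢0 2 m}} large)
    where
    D≈ε : ∀ m → Trivial G (γ (suc (m ℕ.+ i))) →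
          Large K (2 ℕ.^ m) (λ y → f y ≈ d) → ∀ h y → D h f y ≈ ε
    -- Here `D h f` takes values in `γ (suc i)`, already trivial; largeness then serves only to
    -- supply a point of the fibre.
    D≈ε zero    triv large h y = triv (polynomial-value (polynomial-D h pf) y)
    D≈ε (suc m) triv large h   = polynomial-const m
      (≡.subst (λ n → Trivial G (lowerCentral G n)) (≡.sym (ℕ.+-suc m i)) triv)
      (polynomial-D h pf) (D-large pf (2 ℕ.^ m) h large)

-- Word maps as polynomial maps of weight 0

module _ (G : Group c ℓ) {n : ℕ} where
  open Group G
  open PolynomialMaps (G ^ n) G

  eval-polynomial : ∀ {a} {A : Set a} (ρ : (Fin n → Carrier) → A → Carrier) →
    (∀ x → Polynomial 0 (λ h → ρ h x)) →
    (w : GroupWord A) → Polynomial 0 (λ h → eval G (ρ h) w)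
  eval-polynomial ρ ρ-poly []          = const _
  eval-polynomial ρ ρ-poly (pos x ∷ w) = mult (ρ-poly x) (eval-polynomial ρ ρ-poly w)
  eval-polynomial ρ ρ-poly (neg x ∷ w) = mult (inv (ρ-poly x)) (eval-polynomial ρ ρ-poly w)

  value-polynomial : ∀ {l} (v : GroupWord (Fin n ⊎ Fin l)) (g : Fin l → Carrier) →
                     Polynomial 0 (λ h → value G v h g)
  value-polynomial v g = eval-polynomial (λ h → [ h , g ]′)
    -- The variables are the coordinate projections of `G ^ n`, which are homomorphisms; the
    -- parameters are constants.
    (λ { (inj₁ x) → hom (record
           { isRelHomomorphism = record { cong = λ x≈y → x≈y x }
           ; homo = λ _ _ → refl })
       ; (inj₂ _) → const _ }) v

theorem6p5 : ∀ {a ℓ} (G : Group a ℓ) (k : ℕ) →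
    NilpotentOfClass G k →
    let open Group G in
    (n l : ℕ) (v : GroupWord (Fin n ⊎ Fin l))
    (g : Fin l → Carrier) (c : Carrier) →
    Large (G ^ n) (2 ℕ.^ k) (λ h → value G v h g ≈ c) →
    ∀ (h : Fin n → Carrier) → value G v h g ≈ c
theorem6p5 G k (triv , _) n l v g c =
  PolynomialMaps.polynomial-const (G ^ n) G k
    -- At weight 0 with `m = k`, the group required to be trivial is `γ (suc (k + 0))`, which
    -- unfolds to `lowerCentral G (k + 0)`.
    (≡.subst (λ i → Trivial G (lowerCentral G i)) (≡.sym (ℕ.+-identityʳ k)) triv)
    (value-polynomial G v g)
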